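{- Let $p$ be prime, let $c_1,\dots,c_k$ be positive integers, and let $v\ge2$ be an integer coprime to $p$. There exist a collection of $v$-adic intervals $\{I_\ell\}_{\ell\ge1}$ in $[0,1)$ and positive integers $\alpha_\ell$ such that: (1) for each $i\in\{1,\dots,k\}$, letting $J^i_\ell$ be the smallest $pc_i$-adic interval containing $I_\ell$, the intervals $\{J^i_\ell\}_{\ell\ge1}$ are pairwise disjoint and contained in $[0,1)$; in particular the $I_\ell$ are pairwise disjoint; (2) for each $\alpha\in\mathbb{N}$ there are only finitely many $\ell$ with $\alpha_\ell=\alpha$; (3) for each $\ell\ge1$ and each $i$, there is a point $\zeta(J^i_\ell)$ which is an interior endpoint of some $pc_i$-adic child of $J^i_\ell$ such that $$0<\zeta(J^i_\ell)-Z(I_\ell)\le v^{ -100\alpha_\ell}|I_\ell|.$$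
   Context: For a positive integer $N$, the $N$-adic intervals are $[\frac{k-1}{N^s},\frac{k}{N^s})$, $s,k\in\mathbb{Z}$, with $N$-adic children the $N$ equal-length subintervals $[\frac{k-1}{N^s}+\frac{j-1}{N^{s+1}},\frac{k-1}{N^s}+\frac{j}{N^{s+1}})$, $1\le j\le N$. For a $v$-adic interval $I=[\frac{k-1}{v^s},\frac{k}{v^s})$, $Z(I)=\frac{k-1}{v^s}+\frac{v-1}{v^{s+1}}$ is the left endpoint of its last $v$-adic child. An interior endpoint of a child of $J$ is an endpoint of that child lying in the interior of $J$. $|I|$ is the length of $I$. -}

module Defs where

open import Level using (Level; 0ℓ)
open import Data.Nat.Base as ℕ using (ℕ; suc; NonZero)
open import Data.Nat.Properties using (m^n≢0)
open import Data.Integer.Base as ℤ using (ℤ; +_; -[1+_]; 1ℤ)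
open import Data.Rational.Base as ℚ using (ℚ; _/_; _+_; _-_; _≤_; _<_)
open import Data.Fin.Base using (Fin; toℕ)
open import Data.List.Base using (List)
open import Data.List.Membership.Propositional using (_∈_)
open import Data.Product.Base using (∃; _×_)
open import Data.Sum.Base using (_⊎_)
open import Relation.Binary.PropositionalEquality.Core using (_≡_; _≢_)
open import Relation.Unary using (Pred; _⊆_; _⊥_)

private
  variable
    ℓ : Level
    A : Set
    N : ℕ

-- The rational number a / N^s, for an exponent s of either sign.
infix 8 _/[_^_]
_/[_^_] : ℤ → (N : ℕ) → .{{NonZero N}} → ℤ → ℚ
a /[ N ^ + n      ] = _/_ a (N ℕ.^ n) {{m^n≢0 N n}}
a /[ N ^ -[1+ n ] ] = (a ℤ.* + (N ℕ.^ suc n)) / 1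

-- Intervals are sets of rationals.  All endpoints in play are rational, and
-- for such half-open intervals inclusion and disjointness over ℚ and over ℝ
-- agree, since ℚ is dense.
[_,_⟩ : ℚ → ℚ → Pred ℚ 0ℓ
[ a , b ⟩ x = a ≤ x × x < b

-- The N-adic interval [(k-1)/N^s, k/N^s).
record AdicInterval (N : ℕ) : Set where
  constructor adic
  field
    s k : ℤ

module _ .{{_ : NonZero N}} where

  left right length : AdicInterval N → ℚ
  left   (adic s k) = (k ℤ.- 1ℤ) /[ N ^ s ]
  right  (adic s k) = k /[ N ^ s ]
  length I          = right I - left I

  ⟦_⟧ : AdicInterval N → Pred ℚ 0ℓ
  ⟦ I ⟧ = [ left I , right I ⟩

  -- Endpoints of the N-adic children.  Children are indexed from zero, so
  -- j : Fin N is the child numbered toℕ j + 1 when counting from one.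
  childLeft childRight : AdicInterval N → Fin N → ℚ
  childLeft  I@(adic s _) j = left I + (+ toℕ j)       /[ N ^ ℤ.suc s ]
  childRight I@(adic s _) j = left I + (+ suc (toℕ j)) /[ N ^ ℤ.suc s ]

  -- The left endpoint of the last N-adic child.
  Z : AdicInterval N → ℚ
  Z I@(adic s _) = left I + (+ N ℤ.- 1ℤ) /[ N ^ ℤ.suc s ]

  InteriorChildEndpoint : AdicInterval N → Pred ℚ 0ℓ
  InteriorChildEndpoint J ζ =
    (∃ λ j → ζ ≡ childLeft J j ⊎ ζ ≡ childRight J j) × (left J < ζ × ζ < right J)

  SmallestContaining : Pred ℚ 0ℓ → Pred (AdicInterval N) 0ℓ
  SmallestContaining S J = S ⊆ ⟦ J ⟧ × (∀ (J′ : AdicInterval N) → S ⊆ ⟦ J′ ⟧ → ⟦ J ⟧ ⊆ ⟦ J′ ⟧)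

  PairwiseDisjoint : Pred (A → AdicInterval N) 0ℓ
  PairwiseDisjoint I = ∀ a b → a ≢ b → ⟦ I a ⟧ ⊥ ⟦ I b ⟧

-- Only finitely many elements satisfy P: they all occur in one list.
FinitelyMany : Pred A ℓ → Set ℓ
FinitelyMany {A = A} P = ∃ λ (xs : List A) → ∀ x → P x → x ∈ xs

{-# OPTIONS --safe #-}
module Submission where

-- Let P = p^m, where m is a multiple of the order of p modulo v, and V = v^B with
-- v^B ≥ p·c_i for all i.  The common point is ζ = V/P.  As v^T ≡ 1 (mod P) for suitable
-- arbitrarily large T = B + s + 1, we get V·v^(s+1) = 1 + nP, and P ≡ 1 (mod v) forces
-- n ≡ -1 (mod v): so n/v^(s+1) is the left endpoint of the last child of a v-adic interval I
-- of level s, and it lies below ζ by only 1/(P v^(s+1)).  On the other hand ζ is an endpoint of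
-- p·c_i-adic intervals of some level t+1 but not of level t, so it is an interior child endpoint
-- of an interval J of level t, which is the smallest one around I once s is large.  Finally J
-- lies in [ζ/2, 2ζ], and letting m grow makes the ζ decrease fast enough to separate the J.

open import Defs
open import Data.Nat.Base as ℕ using (ℕ; zero; suc; NonZero; NonTrivial; nonTrivial⇒nonZero; _+_; _*_; _^_; z≤n; s≤s)
import Data.Nat.Properties as ℕ
open import Data.Nat.Properties using (m*n≢0)
open import Data.Nat.Divisibility
open import Data.Nat.Primality using (Prime; prime⇒nonZero; prime⇒nonTrivial)
import Data.Nat.Coprimality as Coprimality
open import Data.Nat.Coprimality using (Coprime; coprime-divisor)
open import Data.Nat.DivMod using (_%_; _mod_; m≡m%n+[m/n]*n; m%n<n)
open import Data.Nat.Tactic.RingSolver using (solve-∀)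
open import Data.Integer.Base as ℤ using (ℤ; +_; -[1+_]; 1ℤ)
import Data.Integer.Properties as ℤ
open import Data.Rational.Base as ℚ using (ℚ; _/_; 0ℚ; 1ℚ; toℚᵘ)
import Data.Rational.Properties as ℚ
open import Data.Rational.Unnormalised.Base as ℚᵘ using (mkℚᵘ; _≃_; *≡*; *≤*; *<*)
import Data.Rational.Unnormalised.Properties as ℚᵘ
open import Data.Fin.Base as Fin using (Fin; toℕ; fromℕ<)
import Data.Fin.Properties as Fin
open import Data.List.Base using ([]; _∷_)
open import Data.List.Relation.Unary.Any using (here)
open import Data.Product.Base using (Σ-syntax; ∃-syntax; _×_; _,_; proj₁; proj₂)
open import Data.Sum.Base using (inj₁)
open import Function.Base using (_∘_; it)
open import Relation.Binary.PropositionalEquality hiding (J)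
open import Relation.Binary.Definitions using (tri<; tri≈; tri>)
open import Relation.Nullary using (¬_; Dec; yes; no; contradiction)
open import Relation.Unary using (_⊆_)

-- Order and arithmetic of fractions `a / b` in ℚ.

toℚᵘ-/ : ∀ a b → toℚᵘ (a / suc b) ≃ mkℚᵘ a b
toℚᵘ-/ a b = ℚ.toℚᵘ-fromℚᵘ (mkℚᵘ a b)

/-≡ : ∀ a b c d .{{_ : NonZero b}} .{{_ : NonZero d}} →
      a ℤ.* + d ≡ c ℤ.* + b → a / b ≡ c / d
/-≡ a (suc b) c (suc d) eq = ℚ.fromℚᵘ-cong {mkℚᵘ a b} {mkℚᵘ c d} (*≡* eq)

/-≤ : ∀ a b c d .{{_ : NonZero b}} .{{_ : NonZero d}} →
      a ℤ.* + d ℤ.≤ c ℤ.* + b → a / b ℚ.≤ c / d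
/-≤ a (suc b) c (suc d) a/b≤c/d = ℚ.toℚᵘ-cancel-≤
  (ℚᵘ.≤-respʳ-≃ (ℚᵘ.≃-sym (toℚᵘ-/ c d))
    (ℚᵘ.≤-respˡ-≃ (ℚᵘ.≃-sym (toℚᵘ-/ a b)) (*≤* a/b≤c/d)))

/-< : ∀ a b c d .{{_ : NonZero b}} .{{_ : NonZero d}} →
      a ℤ.* + d ℤ.< c ℤ.* + b → a / b ℚ.< c / d
/-< a (suc b) c (suc d) a/b<c/d = ℚ.toℚᵘ-cancel-<
  (ℚᵘ.<-respʳ-≃ (ℚᵘ.≃-sym (toℚᵘ-/ c d))
    (ℚᵘ.<-respˡ-≃ (ℚᵘ.≃-sym (toℚᵘ-/ a b)) (*<* a/b<c/d)))

/-<⁻¹ : ∀ a b c d .{{_ : NonZero b}} .{{_ : NonZero d}} →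
        a / b ℚ.< c / d → a ℤ.* + d ℤ.< c ℤ.* + b
/-<⁻¹ a (suc b) c (suc d) a/b<c/d = ℚᵘ.drop-*<*
  (ℚᵘ.<-respʳ-≃ (toℚᵘ-/ c d) (ℚᵘ.<-respˡ-≃ (toℚᵘ-/ a b) (ℚ.toℚᵘ-mono-< a/b<c/d)))

/-+ : ∀ a b c d .{{_ : NonZero b}} .{{_ : NonZero d}} .{{_ : NonZero (b * d)}} →
      a / b ℚ.+ c / d ≡ (a ℤ.* + d ℤ.+ c ℤ.* + b) / (b * d)
/-+ a (suc b) c (suc d) = ℚ.toℚᵘ-injective (ℚᵘ.≃-trans
  (ℚ.toℚᵘ-homo-+ (a / suc b) (c / suc d))
  (ℚᵘ.≃-trans (ℚᵘ.+-cong (toℚᵘ-/ a b) (toℚᵘ-/ c d)) (ℚᵘ.≃-sym (toℚᵘ-/ _ _))))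

/-* : ∀ a b c d .{{_ : NonZero b}} .{{_ : NonZero d}} .{{_ : NonZero (b * d)}} →
      a / b ℚ.* (c / d) ≡ (a ℤ.* c) / (b * d)
/-* a (suc b) c (suc d) = ℚ.toℚᵘ-injective (ℚᵘ.≃-trans
  (ℚ.toℚᵘ-homo-* (a / suc b) (c / suc d))
  (ℚᵘ.≃-trans (ℚᵘ.*-cong (toℚᵘ-/ a b) (toℚᵘ-/ c d)) (ℚᵘ.≃-sym (toℚᵘ-/ _ _))))

module _ (a b c d : ℕ) .{{_ : NonZero b}} .{{_ : NonZero d}} where

  pos/-≤ : a * d ℕ.≤ c * b → + a / b ℚ.≤ + c / d
  pos/-≤ a/b≤c/d = /-≤ (+ a) b (+ c) d (subst₂ ℤ._≤_ (ℤ.pos-* a d) (ℤ.pos-* c b) (ℤ.+≤+ a/b≤c/d))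

  pos/-< : a * d ℕ.< c * b → + a / b ℚ.< + c / d
  pos/-< a/b<c/d = /-< (+ a) b (+ c) d (subst₂ ℤ._<_ (ℤ.pos-* a d) (ℤ.pos-* c b) (ℤ.+<+ a/b<c/d))

  module _ (e f : ℕ) .{{_ : NonZero f}} where

    pos/-+ : (a * d + c * b) * f ≡ e * (b * d) → + a / b ℚ.+ + c / d ≡ + e / f
    pos/-+ eq = trans (/-+ (+ a) b (+ c) d) (/-≡ (+ a ℤ.* + d ℤ.+ + c ℤ.* + b) (b * d) (+ e) f (begin
      (+ a ℤ.* + d ℤ.+ + c ℤ.* + b) ℤ.* + f ≡⟨ cong (ℤ._* + f) (cong₂ ℤ._+_ (ℤ.pos-* a d) (ℤ.pos-* c b)) ⟨
      + (a * d + c * b) ℤ.* + f             ≡⟨ ℤ.pos-* (a * d + c * b) f ⟨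
      + ((a * d + c * b) * f)               ≡⟨ cong +_ eq ⟩
      + (e * (b * d))                       ≡⟨ ℤ.pos-* e (b * d) ⟩
      + e ℤ.* + (b * d)                     ∎))
      where
      open ≡-Reasoning
      instance
        bd≢0 : NonZero (b * d)
        bd≢0 = ℕ.m*n≢0 b d

    -- Differences are read off from sums proved by `pos/-+`, so numerators are never subtracted in
    -- ℕ.
    pos/-minus : + a / b ℚ.+ + c / d ≡ + e / f → + e / f ℚ.- + c / d ≡ + a / b
    pos/-minus eq = begin
      + e / f ℚ.- + c / d                 ≡⟨ cong (ℚ._- + c / d) eq ⟨
      (+ a / b ℚ.+ + c / d) ℚ.- + c / d   ≡⟨ ℚ.+-assoc (+ a / b) (+ c / d) (ℚ.- (+ c / d)) ⟩
      + a / b ℚ.+ (+ c / d ℚ.- + c / d)   ≡⟨ cong (+ a / b ℚ.+_) (ℚ.+-inverseʳ (+ c / d)) ⟩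
      + a / b ℚ.+ 0ℚ                      ≡⟨ ℚ.+-identityʳ (+ a / b) ⟩
      + a / b                             ∎
      where open ≡-Reasoning

pos/-* : ∀ a b c d .{{_ : NonZero b}} .{{_ : NonZero d}} .{{_ : NonZero (b * d)}} →
         + a / b ℚ.* (+ c / d) ≡ + (a * c) / (b * d)
pos/-* a b c d = trans (/-* (+ a) b (+ c) d) (cong (_/ (b * d)) (sym (ℤ.pos-* a c)))

^-monoʳ-∣ : ∀ m {n o} → n ℕ.≤ o → m ^ n ∣ m ^ o
^-monoʳ-∣ m {n} {o} n≤o =
  subst (m ^ n ∣_) (trans (sym (ℕ.^-distribˡ-+-* m n (o ℕ.∸ n))) (cong (m ^_) (ℕ.m+[n∸m]≡n n≤o)))
    (m∣m*n (m ^ (o ℕ.∸ n)))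

[i-1]+1≡i : ∀ i → ℤ.suc (i ℤ.- 1ℤ) ≡ i
[i-1]+1≡i i = trans (cong ℤ.suc (ℤ.+-comm i (ℤ.- 1ℤ))) (ℤ.suc-pred i)

private
  swap : ∀ a b c → a * b * c ≡ a * c * b
  swap = solve-∀

  reorder : ∀ a b c → a * b * c ≡ a * (c * b)
  reorder = solve-∀

-- The base-`N` interval `J` around ζ: child endpoint and minimality.

module InteriorPoint (N t q V P : ℕ) .{{_ : NonZero N}} .{{_ : NonZero P}}
  (qP<VM : q * P ℕ.< V * N ^ t) (VM<[1+q]P : V * N ^ t ℕ.< suc q * P)
  (P∣NM : P ∣ N ^ suc t) where

  private
    M : ℕ
    M = N ^ t

    instance
      M≢0 : NonZero M
      M≢0 = ℕ.m^n≢0 N t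

      NM≢0 : NonZero (N * M)
      NM≢0 = ℕ.m^n≢0 N (suc t)

    ζ : ℚ
    ζ = + V / P

  J : AdicInterval N
  J = adic (+ t) (+ suc q)

  -- As `P` divides N^(t+1), ζ is a multiple of 1/N^(t+1); lying strictly inside `J`, it must be the
  -- left end of a child.
  interiorChildEndpoint : InteriorChildEndpoint J ζ
  interiorChildEndpoint = (fromℕ< i<N , inj₁ ζ≡) , pos/-< q M V P qP<VM , pos/-< V P (suc q) M VM<[1+q]P
    where
    h i : ℕ
    h = quotient P∣NM
    -- ζ = Vh/N^(t+1) and `left J` = qN/N^(t+1), so `i` counts the children to the left of ζ. By
    -- `qN<Vh` the truncated subtraction is exact.
    i = V * h ℕ.∸ q * N

    scale : V * M * N ≡ V * h * P
    scale = begin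
      V * M * N   ≡⟨ reorder V M N ⟩
      V * (N * M) ≡⟨ cong (V *_) (m∣n⇒n≡quotient*m P∣NM) ⟩
      V * (h * P) ≡⟨ ℕ.*-assoc V h P ⟨
      V * h * P   ∎
      where open ≡-Reasoning

    qN<Vh : q * N ℕ.< V * h
    qN<Vh = ℕ.*-cancelʳ-< P (q * N) (V * h) (begin-strict
      q * N * P ≡⟨ swap q N P ⟩
      q * P * N <⟨ ℕ.*-monoˡ-< N qP<VM ⟩
      V * M * N ≡⟨ scale ⟩
      V * h * P ∎)
      where open ℕ.≤-Reasoning

    Vh<[1+q]N : V * h ℕ.< suc q * N
    Vh<[1+q]N = ℕ.*-cancelʳ-< P (V * h) (suc q * N) (begin-strict
      V * h * P     ≡⟨ scale ⟨
      V * M * N     <⟨ ℕ.*-monoˡ-< N VM<[1+q]P ⟩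
      suc q * P * N ≡⟨ swap (suc q) P N ⟩
      suc q * N * P ∎)
      where open ℕ.≤-Reasoning

    i+qN≡Vh : i + q * N ≡ V * h
    i+qN≡Vh = ℕ.m∸n+n≡m (ℕ.<⇒≤ qN<Vh)

    i<N : i ℕ.< N
    i<N = ℕ.+-cancelʳ-< (q * N) i N (subst (ℕ._< N + q * N) (sym i+qN≡Vh) Vh<[1+q]N)

    ζ≡ : ζ ≡ childLeft J (fromℕ< i<N)
    ζ≡ = sym (trans (cong (λ j → + q / M ℚ.+ + j / (N * M)) (Fin.toℕ-fromℕ< i<N))
      (pos/-+ q M i (N * M) V P (begin
        (q * (N * M) + i * M) * P ≡⟨ collect q N M i P ⟩
        (i + q * N) * P * M       ≡⟨ cong (λ x → x * P * M) i+qN≡Vh ⟩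
        V * h * P * M             ≡⟨ cong (_* M) scale ⟨
        V * M * N * M             ≡⟨ reassoc V M N ⟩
        V * (M * (N * M))         ∎)))
      where
      open ≡-Reasoning
      collect : ∀ q n m i p → (q * (n * m) + i * m) * p ≡ (i + q * n) * p * m
      collect = solve-∀
      reassoc : ∀ v m n → v * m * n * m ≡ v * (m * (n * m))
      reassoc = solve-∀

  private
    -- Refining to level t turns the endpoints of a coarser interval into multiples of 1/M.
    nested-coarse : ∀ (s k : ℤ) X → (∀ a → a /[ N ^ s ] ≡ (a ℤ.* + X) / M) →
                    left (adic {N} s k) ℚ.< ζ → ζ ℚ.< right (adic {N} s k) → ⟦ J ⟧ ⊆ ⟦ adic {N} s k ⟧
    nested-coarse s k X refine l<ζ ζ<r (l≤x , x<r) =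
        ℚ.≤-trans (subst (ℚ._≤ + q / M) (sym (refine (k ℤ.- 1ℤ))) lower) l≤x
      , ℚ.<-≤-trans x<r (subst (+ suc q / M ℚ.≤_) (sym (refine k)) upper)
      where
      a b : ℤ
      a = (k ℤ.- 1ℤ) ℤ.* + X
      b = k ℤ.* + X

      a<1+q : a ℤ.< + suc q
      a<1+q = ℤ.*-cancelʳ-<-nonNeg (+ P) (ℤ.<-trans
        (/-<⁻¹ a M (+ V) P (subst (ℚ._< ζ) (refine (k ℤ.- 1ℤ)) l<ζ))
        (subst₂ ℤ._<_ (ℤ.pos-* V M) (ℤ.pos-* (suc q) P) (ℤ.+<+ VM<[1+q]P)))

      q<b : + q ℤ.< b
      q<b = ℤ.*-cancelʳ-<-nonNeg (+ P) (ℤ.<-trans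
        (subst₂ ℤ._<_ (ℤ.pos-* q P) (ℤ.pos-* V M) (ℤ.+<+ qP<VM))
        (/-<⁻¹ (+ V) P b M (subst (ζ ℚ.<_) (refine k) ζ<r)))

      lower : a / M ℚ.≤ + q / M
      lower = /-≤ a M (+ q) M (ℤ.*-monoʳ-≤-nonNeg (+ M) (ℤ.i<j⇒i≤pred[j] a<1+q))

      upper : + suc q / M ℚ.≤ b / M
      upper = /-≤ (+ suc q) M b M (ℤ.*-monoʳ-≤-nonNeg (+ M) (ℤ.i<j⇒suc[i]≤j q<b))

    -- At levels n > t, ζ is itself a multiple of 1/N^n.
    ζ∉interior-fine : ∀ n (k : ℤ) → suc t ℕ.≤ n →
                      left (adic {N} (+ n) k) ℚ.< ζ → ¬ (ζ ℚ.< right (adic {N} (+ n) k))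
    ζ∉interior-fine n k t<n l<ζ ζ<r = ℤ.<⇒≱ u<k (subst (ℤ._≤ + u) ([i-1]+1≡i k) (ℤ.i<j⇒suc[i]≤j k-1<u))
      where
      instance
        N^n≢0 : NonZero (N ^ n)
        N^n≢0 = ℕ.m^n≢0 N n
      P∣N^n : P ∣ N ^ n
      P∣N^n = ∣-trans P∣NM (^-monoʳ-∣ N t<n)
      h u : ℕ
      h = quotient P∣N^n
      u = V * h
      V*N^n≡u*P : + V ℤ.* + (N ^ n) ≡ + u ℤ.* + P
      V*N^n≡u*P = begin
        + V ℤ.* + (N ^ n) ≡⟨ ℤ.pos-* V (N ^ n) ⟨
        + (V * N ^ n)     ≡⟨ cong (λ x → + (V * x)) (m∣n⇒n≡quotient*m P∣N^n) ⟩
        + (V * (h * P))   ≡⟨ cong +_ (sym (ℕ.*-assoc V h P)) ⟩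
        + (u * P)         ≡⟨ ℤ.pos-* u P ⟩
        + u ℤ.* + P       ∎
        where open ≡-Reasoning
      k-1<u : k ℤ.- 1ℤ ℤ.< + u
      k-1<u = ℤ.*-cancelʳ-<-nonNeg (+ P)
        (subst ((k ℤ.- 1ℤ) ℤ.* + P ℤ.<_) V*N^n≡u*P (/-<⁻¹ (k ℤ.- 1ℤ) (N ^ n) (+ V) P l<ζ))
      u<k : + u ℤ.< k
      u<k = ℤ.*-cancelʳ-<-nonNeg (+ P)
        (subst (ℤ._< k ℤ.* + P) V*N^n≡u*P (/-<⁻¹ (+ V) P k (N ^ n) ζ<r))

  -- The grids of multiples of 1/N^n are nested. An interval of level at most `t` around ζ has its
  -- ends on the grid of `J` and cannot cut `J`; at finer levels ζ is itself a grid point, so it is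
  -- never interior.
  nested : ∀ (J′ : AdicInterval N) → left J′ ℚ.< ζ → ζ ℚ.< right J′ → ⟦ J ⟧ ⊆ ⟦ J′ ⟧
  nested (adic (+ n) k) l<ζ ζ<r with n ℕ.≤? t
  ... | no n≰t = contradiction ζ<r (ζ∉interior-fine n k (ℕ.≰⇒> n≰t) l<ζ)
  ... | yes n≤t = nested-coarse (+ n) k (N ^ (t ℕ.∸ n)) refine l<ζ ζ<r
    where
    instance
      N^n≢0 : NonZero (N ^ n)
      N^n≢0 = ℕ.m^n≢0 N n
    M≡ : M ≡ N ^ (t ℕ.∸ n) * N ^ n
    M≡ = trans (cong (N ^_) (sym (ℕ.m∸n+n≡m n≤t))) (ℕ.^-distribˡ-+-* N (t ℕ.∸ n) n)
    refine : ∀ a → a / (N ^ n) ≡ (a ℤ.* + (N ^ (t ℕ.∸ n))) / M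
    refine a = /-≡ a (N ^ n) (a ℤ.* + (N ^ (t ℕ.∸ n))) M (begin
      a ℤ.* + M                                  ≡⟨ cong (λ x → a ℤ.* + x) M≡ ⟩
      a ℤ.* + (N ^ (t ℕ.∸ n) * N ^ n)            ≡⟨ cong (a ℤ.*_) (ℤ.pos-* (N ^ (t ℕ.∸ n)) (N ^ n)) ⟩
      a ℤ.* (+ (N ^ (t ℕ.∸ n)) ℤ.* + (N ^ n))    ≡⟨ ℤ.*-assoc a _ _ ⟨
      a ℤ.* + (N ^ (t ℕ.∸ n)) ℤ.* + (N ^ n)      ∎)
      where open ≡-Reasoning
  nested (adic -[1+ n ] k) l<ζ ζ<r = nested-coarse -[1+ n ] k (N ^ suc n * M) refine l<ζ ζ<r
    where
    refine : ∀ a → (a ℤ.* + (N ^ suc n)) / 1 ≡ (a ℤ.* + (N ^ suc n * M)) / M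
    refine a = /-≡ (a ℤ.* + (N ^ suc n)) 1 (a ℤ.* + (N ^ suc n * M)) M (begin
      a ℤ.* + (N ^ suc n) ℤ.* + M     ≡⟨ ℤ.*-assoc a (+ (N ^ suc n)) (+ M) ⟩
      a ℤ.* (+ (N ^ suc n) ℤ.* + M)   ≡⟨ cong (a ℤ.*_) (ℤ.pos-* (N ^ suc n) M) ⟨
      a ℤ.* + (N ^ suc n * M)         ≡⟨ ℤ.*-identityʳ _ ⟨
      a ℤ.* + (N ^ suc n * M) ℤ.* 1ℤ  ∎)
      where open ≡-Reasoning

-- The v-adic interval `I` whose last child starts just below ζ.

private
  pos-pred : ∀ n .{{_ : NonZero n}} → + n ℤ.- 1ℤ ≡ + ℕ.pred n
  pos-pred (suc n) = refl

-- The equation for `suc n` says n = kv + (v-1), so n/v^(s+1) is the left end of the last child of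
-- [k/v^s, (k+1)/v^s). The other equation says ζ - n/v^(s+1) = 1/(P v^(s+1)).
module LastChild (v s k n V P : ℕ) .{{_ : NonZero v}} .{{_ : NonZero P}}
  (1<P : 1 ℕ.< P) (1+n≡[1+k]v : suc n ≡ suc k * v) (V[vS]≡1+nP : V * v ^ suc s ≡ suc (n * P)) where

  private
    S : ℕ
    S = v ^ s

    instance
      S≢0 : NonZero S
      S≢0 = ℕ.m^n≢0 v s

      vS≢0 : NonZero (v * S)
      vS≢0 = ℕ.m^n≢0 v (suc s)

      PvS≢0 : NonZero (P * (v * S))
      PvS≢0 = ℕ.m*n≢0 P (v * S)

    ζ : ℚ
    ζ = + V / P

    n≡kv+pred[v] : n ≡ k * v + ℕ.pred v
    n≡kv+pred[v] = ℕ.suc-injective (begin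
      suc n                  ≡⟨ 1+n≡[1+k]v ⟩
      v + k * v              ≡⟨ ℕ.+-comm v (k * v) ⟩
      k * v + v              ≡⟨ cong (λ x → k * v + x) (ℕ.suc-pred v) ⟨
      k * v + suc (ℕ.pred v) ≡⟨ ℕ.+-suc (k * v) (ℕ.pred v) ⟩
      suc (k * v + ℕ.pred v) ∎)
      where open ≡-Reasoning

  kP<VS : k * P ℕ.< V * S
  kP<VS = ℕ.*-cancelʳ-< v (k * P) (V * S) (begin-strict
    k * P * v   ≡⟨ swap k P v ⟩
    k * v * P   ≤⟨ ℕ.*-monoˡ-≤ P (subst (k * v ℕ.≤_) (sym n≡kv+pred[v]) (ℕ.m≤m+n (k * v) (ℕ.pred v))) ⟩
    n * P       <⟨ ℕ.n<1+n (n * P) ⟩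
    suc (n * P) ≡⟨ V[vS]≡1+nP ⟨
    V * (v * S) ≡⟨ reorder V S v ⟨
    V * S * v   ∎)
    where open ℕ.≤-Reasoning

  -- ζ exceeds `Z I` by 1/P of the length of a child, and `1<P` keeps it inside that last child.
  VS<[1+k]P : V * S ℕ.< suc k * P
  VS<[1+k]P = ℕ.*-cancelʳ-< v (V * S) (suc k * P) (begin-strict
    V * S * v     ≡⟨ reorder V S v ⟩
    V * (v * S)   ≡⟨ V[vS]≡1+nP ⟩
    1 + n * P     <⟨ ℕ.+-monoˡ-< (n * P) 1<P ⟩
    suc n * P     ≡⟨ cong (_* P) 1+n≡[1+k]v ⟩
    suc k * v * P ≡⟨ swap (suc k) v P ⟩
    suc k * P * v ∎)
    where open ℕ.≤-Reasoning

  I : AdicInterval v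
  I = adic (+ s) (+ suc k)

  left<ζ : left I ℚ.< ζ
  left<ζ = pos/-< k S V P kP<VS

  ζ<right : ζ ℚ.< right I
  ζ<right = pos/-< V P (suc k) S VS<[1+k]P

  left∈I : ⟦ I ⟧ (left I)
  left∈I = ℚ.≤-refl , ℚ.<-trans left<ζ ζ<right

  ζ∈I : ⟦ I ⟧ ζ
  ζ∈I = ℚ.<⇒≤ left<ζ , ζ<right

  private
    length≡ : length I ≡ + 1 / S
    length≡ = pos/-minus 1 S k S (suc k) S (pos/-+ 1 S k S (suc k) S (algebra k S))
      where
      algebra : ∀ k S → (1 * S + k * S) * S ≡ suc k * (S * S)
      algebra = solve-∀

    Z≡ : Z I ≡ + n / (v * S)
    Z≡ = trans (cong (λ x → + k / S ℚ.+ x / (v * S)) (pos-pred v))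
      (pos/-+ k S (ℕ.pred v) (v * S) n (v * S) (begin
        (k * (v * S) + ℕ.pred v * S) * (v * S) ≡⟨ collect k v S (ℕ.pred v) ⟩
        (k * v + ℕ.pred v) * (S * (v * S))     ≡⟨ cong (_* (S * (v * S))) n≡kv+pred[v] ⟨
        n * (S * (v * S))                      ∎))
      where
      open ≡-Reasoning
      collect : ∀ k v S u → (k * (v * S) + u * S) * (v * S) ≡ (k * v + u) * (S * (v * S))
      collect = solve-∀

    ζ-Z≡ : ζ ℚ.- Z I ≡ + 1 / (P * (v * S))
    ζ-Z≡ = trans (cong (λ x → ζ ℚ.- x) Z≡) (pos/-minus 1 (P * (v * S)) n (v * S) V P
      (pos/-+ 1 (P * (v * S)) n (v * S) V P (begin
        (1 * (v * S) + n * (P * (v * S))) * P ≡⟨ collect (v * S) n P ⟩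
        suc (n * P) * (P * (v * S))           ≡⟨ cong (_* (P * (v * S))) V[vS]≡1+nP ⟨
        V * (v * S) * (P * (v * S))           ≡⟨ reorder V (v * S) (P * (v * S)) ⟩
        V * ((P * (v * S)) * (v * S))         ∎)))
      where
      open ≡-Reasoning
      collect : ∀ x n P → (1 * x + n * (P * x)) * P ≡ suc (n * P) * (P * x)
      collect = solve-∀

  0<ζ-Z : 0ℚ ℚ.< ζ ℚ.- Z I
  0<ζ-Z = subst (0ℚ ℚ.<_) (sym ζ-Z≡) (pos/-< 0 1 1 (P * (v * S)) (s≤s z≤n))

  -- The gap 1/(P v^(s+1)) equals |I|/(Pv), hence is at most |I|/P. `W` will be v^(100α).
  ζ-Z≤ : ∀ W .{{_ : NonZero W}} → W ℕ.≤ P → ζ ℚ.- Z I ℚ.≤ 1ℤ / W ℚ.* length I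
  ζ-Z≤ W W≤P = begin
    ζ ℚ.- Z I            ≡⟨ ζ-Z≡ ⟩
    + 1 / (P * (v * S))  ≤⟨ pos/-≤ 1 (P * (v * S)) 1 (W * S)
                              (ℕ.*-monoʳ-≤ 1 (ℕ.*-mono-≤ W≤P (ℕ.m≤n*m S v))) ⟩
    + 1 / (W * S)        ≡⟨ pos/-* 1 W 1 S ⟨
    1ℤ / W ℚ.* (+ 1 / S) ≡⟨ cong (1ℤ / W ℚ.*_) length≡ ⟨
    1ℤ / W ℚ.* length I  ∎
    where
    open ℚ.≤-Reasoning
    instance
      WS≢0 : NonZero (W * S)
      WS≢0 = ℕ.m*n≢0 W S

  -- ζ = V/P is at distance at least 1/(PM) from the multiples q/M and (1+q)/M, which exceeds |I|.
  module _ (M q : ℕ) .{{_ : NonZero M}} (qP<VM : q * P ℕ.< V * M) (VM<[1+q]P : V * M ℕ.< suc q * P)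
    (PM≤S : P * M ℕ.≤ S) where

    q/M≤left : + q / M ℚ.≤ left I
    -- Strictness of `qP<VM` is worth one extra `S`, which pays for the term `P * M`; then `S` is
    -- cancelled.
    q/M≤left = pos/-≤ q M k S (ℕ.*-cancelʳ-≤ (q * S) (k * M) P (ℕ.+-cancelˡ-≤ S _ _ (begin
      S + q * S * P      ≡⟨ collect S q P ⟩
      suc (q * P) * S    ≤⟨ ℕ.*-monoˡ-≤ S qP<VM ⟩
      V * M * S          ≡⟨ swap V M S ⟩
      V * S * M          ≤⟨ ℕ.*-monoˡ-≤ M (ℕ.<⇒≤ VS<[1+k]P) ⟩
      suc k * P * M      ≡⟨ expand k P M ⟩
      P * M + k * M * P  ≤⟨ ℕ.+-monoˡ-≤ (k * M * P) PM≤S ⟩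
      S + k * M * P      ∎)))
      where
      open ℕ.≤-Reasoning
      collect : ∀ S q P → S + q * S * P ≡ suc (q * P) * S
      collect = solve-∀
      expand : ∀ k P M → suc k * P * M ≡ P * M + k * M * P
      expand = solve-∀

    right≤[1+q]/M : right I ℚ.≤ + suc q / M
    right≤[1+q]/M = pos/-≤ (suc k) S (suc q) M (ℕ.*-cancelʳ-≤ (suc k * M) (suc q * S) P (begin
      suc k * M * P      ≡⟨ expand k M P ⟩
      k * P * M + P * M  ≤⟨ ℕ.+-mono-≤ (ℕ.*-monoˡ-≤ M (ℕ.<⇒≤ kP<VS)) PM≤S ⟩
      V * S * M + S      ≡⟨ collect V S M ⟩
      suc (V * M) * S    ≤⟨ ℕ.*-monoˡ-≤ S VM<[1+q]P ⟩
      suc q * P * S      ≡⟨ swap (suc q) P S ⟩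
      suc q * S * P      ∎))
      where
      open ℕ.≤-Reasoning
      expand : ∀ k M P → suc k * M * P ≡ k * P * M + P * M
      expand = solve-∀
      collect : ∀ V S M → V * S * M + S ≡ suc (V * M) * S
      collect = solve-∀

-- Powers, coprimality and multiplicative order.

n<m^n : ∀ m n .{{_ : NonTrivial m}} → n ℕ.< m ^ n
n<m^n m zero    = s≤s z≤n
n<m^n m (suc n) = begin-strict
  suc n         ≤⟨ n<m^n m n ⟩
  m ^ n         <⟨ ℕ.m<m+n (m ^ n) (ℕ.m^n>0 m n) ⟩
  m ^ n + m ^ n ≡⟨ cong (λ x → m ^ n + x) (ℕ.+-identityʳ (m ^ n)) ⟨
  2 * m ^ n     ≤⟨ ℕ.*-monoˡ-≤ (m ^ n) (ℕ.nonTrivial⇒n>1 m) ⟩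
  m * m ^ n     ∎
  where
  open ℕ.≤-Reasoning
  instance
    m≢0 : NonZero m
    m≢0 = nonTrivial⇒nonZero m

^-monoˡ-∣ : ∀ {m n} o → m ∣ n → m ^ o ∣ n ^ o
^-monoˡ-∣ zero    m∣n = ∣-refl
^-monoˡ-∣ (suc o) m∣n = *-pres-∣ m∣n (^-monoˡ-∣ o m∣n)

coprime-^ : ∀ {m n} k → Coprime m n → Coprime m (n ^ k)
coprime-^ zero    m⊥n (_ , d∣1)         = ∣1⇒≡1 d∣1
coprime-^ (suc k) m⊥n (d∣m , d∣n*n^k) = coprime-^ k m⊥n (d∣m , coprime-divisor d⊥n d∣n*n^k)
  where
  d⊥n : Coprime _ _
  d⊥n (e∣d , e∣n) = m⊥n (∣-trans e∣d d∣m , e∣n)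

%-≡⇒∣ : ∀ m n o .{{_ : NonZero o}} → m % o ≡ (m + n) % o → o ∣ n
%-≡⇒∣ m n o eq = ∣m+n∣m⇒∣n (divides ((m + n) ℕ./ o) m/o*o+n≡) (n∣m*n (m ℕ./ o))
  where
  m/o*o+n≡ : (m ℕ./ o) * o + n ≡ ((m + n) ℕ./ o) * o
  m/o*o+n≡ = ℕ.+-cancelˡ-≡ (m % o) _ _ (begin
    m % o + ((m ℕ./ o) * o + n)           ≡⟨ ℕ.+-assoc (m % o) _ n ⟨
    m % o + (m ℕ./ o) * o + n             ≡⟨ cong (λ x → x + n) (m≡m%n+[m/n]*n m o) ⟨
    m + n                                 ≡⟨ m≡m%n+[m/n]*n (m + n) o ⟩
    (m + n) % o + ((m + n) ℕ./ o) * o     ≡⟨ cong (λ x → x + ((m + n) ℕ./ o) * o) eq ⟨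
    m % o + ((m + n) ℕ./ o) * o           ∎)
    where open ≡-Reasoning

-- Abstract, since otherwise the pigeonhole search below gets unfolded in the exponents.
abstract
  order : ∀ a m .{{_ : NonZero a}} .{{_ : NonZero m}} → Coprime m a →
          ∃[ d ] ∃[ w ] a ^ suc d ≡ suc (w * m)
  -- Among the m+1 powers a^0, ..., a^m two agree modulo `m`, say a^x and a^y with x < y. Cancelling
  -- a^x, which is coprime to `m`, leaves a^(y-x) ≡ 1, where y - x = 1 + d is positive.
  order a m m⊥a with Fin.pigeonhole (ℕ.n<1+n m) (λ i → (a ^ toℕ i) mod m)
  ... | i , j , i<j , eq = d , quotient m∣e , trans (sym 1+e≡) (cong suc (m∣n⇒n≡quotient*m m∣e))
    where
    x y d e : ℕ
    x = toℕ i
    y = toℕ j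
    d = y ℕ.∸ suc x
    e = ℕ.pred (a ^ suc d)

    1+e≡ : suc e ≡ a ^ suc d
    1+e≡ = ℕ.suc-pred (a ^ suc d) {{ℕ.m^n≢0 a (suc d)}}

    a^y≡ : a ^ y ≡ a ^ x + a ^ x * e
    a^y≡ = begin
      a ^ y               ≡⟨ cong (a ^_) (trans (ℕ.+-suc x d) (ℕ.m+[n∸m]≡n i<j)) ⟨
      a ^ (x + suc d)     ≡⟨ ℕ.^-distribˡ-+-* a x (suc d) ⟩
      a ^ x * a ^ suc d   ≡⟨ cong (a ^ x *_) 1+e≡ ⟨
      a ^ x * suc e       ≡⟨ ℕ.*-suc (a ^ x) e ⟩
      a ^ x + a ^ x * e   ∎
      where open ≡-Reasoning

    a^x%m≡a^y%m : a ^ x % m ≡ a ^ y % m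
    a^x%m≡a^y%m = trans (sym (Fin.toℕ-fromℕ< (m%n<n (a ^ x) m)))
      (trans (cong toℕ eq) (Fin.toℕ-fromℕ< (m%n<n (a ^ y) m)))

    m∣e : m ∣ e
    m∣e = coprime-divisor (coprime-^ x m⊥a)
      (%-≡⇒∣ (a ^ x) (a ^ x * e) m (trans a^x%m≡a^y%m (cong (_% m) a^y≡)))

  ≡1-^ : ∀ {m a w} → a ≡ suc (w * m) → ∀ t → ∃[ w′ ] a ^ t ≡ suc (w′ * m)
  ≡1-^ a≡ zero = 0 , refl
  ≡1-^ {m} {a} {w} a≡ (suc t) with ≡1-^ {w = w} a≡ t
  ... | w′ , a^t≡ = w′ + w * suc (w′ * m) , trans (cong₂ _*_ a≡ a^t≡) (algebra w w′ m)
    where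
    algebra : ∀ w u m → suc (w * m) * suc (u * m) ≡ suc ((u + w * suc (u * m)) * m)
    algebra = solve-∀

-- The level of `J`, and its endpoints compared with ζ.

-- Used with `P ∣ N ^ t` as `Q t`: it finds a level t where ζ is not yet a grid point although it is
-- one at level t+1.
crossing : ∀ {Q : ℕ → Set} → (∀ n → Dec (Q n)) → ¬ Q 0 → ∀ m → Q m →
           ∃[ t ] t ℕ.< m × ¬ Q t × Q (suc t)
crossing Q? ¬Q0 zero    Q0 = contradiction Q0 ¬Q0
crossing Q? ¬Q0 (suc m) Qm with Q? m
... | no ¬Qm = m , ℕ.n<1+n m , ¬Qm , Qm
... | yes Qm′ with crossing Q? ¬Q0 m Qm′
...   | t , t<m , found = t , ℕ.m<n⇒m<1+n t<m , found

-- [q/N^t, (1+q)/N^t) is the interval J around ζ = V/P.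
record Enclosure (N V P m : ℕ) : Set where
  field
    t q       : ℕ
    t<m       : t ℕ.< m
    0<q       : 0 ℕ.< q
    qP<VM     : q * P ℕ.< V * N ^ t
    VM<[1+q]P : V * N ^ t ℕ.< suc q * P
    P∣NM      : P ∣ N ^ suc t

abstract
  -- `q` is the integer part of V N^t / P. Since `P` is coprime to `V` and does not divide N^t, the
  -- remainder is nonzero and the lower bound strict. That q ≥ 1 comes from P ≤ N^(t+1) ≤ V N^t,
  -- which is why ζ has numerator `V` rather than 1.
  enclose : ∀ {N V P m} .{{_ : NonZero N}} .{{_ : NonZero P}} →
            N ℕ.≤ V → 1 ℕ.< P → Coprime P V → P ∣ N ^ m → Enclosure N V P m
  enclose {N} {V} {P} {m} N≤V 1<P P⊥V P∣N^m
    with crossing (λ t → P ∣? N ^ t) (λ P∣1 → ℕ.<⇒≢ 1<P (sym (∣1⇒≡1 P∣1))) m P∣N^m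
  ... | t , t<m , P∤M , P∣NM = record
    { t = t ; q = q ; t<m = t<m ; 0<q = ℕ.≰⇒> q≰0 ; qP<VM = qP<VM ; VM<[1+q]P = VM<[1+q]P ; P∣NM = P∣NM }
    where
    VM q : ℕ
    VM = V * N ^ t
    q  = VM ℕ./ P

    r≢0 : VM % P ≢ 0
    r≢0 r≡0 = P∤M (coprime-divisor P⊥V (m%n≡0⇒n∣m VM P r≡0))

    qP<VM : q * P ℕ.< VM
    qP<VM = subst (q * P ℕ.<_) (sym (m≡m%n+[m/n]*n VM P)) (ℕ.m<n+m (q * P) (ℕ.n≢0⇒n>0 r≢0))

    VM<[1+q]P : VM ℕ.< suc q * P
    VM<[1+q]P = subst (ℕ._< P + q * P) (sym (m≡m%n+[m/n]*n VM P)) (ℕ.+-monoˡ-< (q * P) (m%n<n VM P))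

    P≤VM : P ℕ.≤ VM
    P≤VM = ℕ.≤-trans (∣⇒≤ {{ℕ.m^n≢0 N (suc t)}} P∣NM) (ℕ.*-monoˡ-≤ (N ^ t) N≤V)

    q≰0 : ¬ (q ℕ.≤ 0)
    q≰0 q≤0 = ℕ.<⇒≱ VM<[1+q]P (ℕ.≤-trans (ℕ.*-monoˡ-≤ P (s≤s q≤0)) (subst (ℕ._≤ VM) (sym (ℕ.*-identityˡ P)) P≤VM))

module _ {N V P m} .{{_ : NonZero N}} .{{_ : NonZero P}} (E : Enclosure N V P m) where
  open Enclosure E

  private
    M : ℕ
    M = N ^ t
    instance
      M≢0 : NonZero M
      M≢0 = ℕ.m^n≢0 N t

  private
    -- As q ≥ 1, the right end of `J` is at most twice the left end, so both are within a factor 2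
    -- of ζ.
    [1+q]P≤2qP : suc q * P ℕ.≤ 2 * (q * P)
    [1+q]P≤2qP = begin
      suc q * P   ≤⟨ ℕ.*-monoˡ-≤ P (ℕ.+-monoˡ-≤ q 0<q) ⟩
      (q + q) * P ≡⟨ double q P ⟩
      2 * (q * P) ∎
      where
      open ℕ.≤-Reasoning
      double : ∀ q P → (q + q) * P ≡ 2 * (q * P)
      double = solve-∀

  [1+q]P≤2VM : suc q * P ℕ.≤ 2 * (V * M)
  [1+q]P≤2VM = ℕ.≤-trans [1+q]P≤2qP (ℕ.*-monoʳ-≤ 2 (ℕ.<⇒≤ qP<VM))

  VM≤2qP : V * M ℕ.≤ 2 * (q * P)
  VM≤2qP = ℕ.≤-trans (ℕ.<⇒≤ VM<[1+q]P) [1+q]P≤2qP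

  enclosure≤1 : 2 * V ℕ.≤ P → + suc q / M ℚ.≤ 1ℚ
  enclosure≤1 2V≤P = pos/-≤ (suc q) M 1 1 (subst₂ ℕ._≤_ (sym (ℕ.*-identityʳ (suc q))) (sym (ℕ.*-identityˡ M))
    (ℕ.*-cancelʳ-≤ (suc q) M P (begin
      suc q * P       ≤⟨ [1+q]P≤2VM ⟩
      2 * (V * M)     ≡⟨ ℕ.*-assoc 2 V M ⟨
      2 * V * M       ≤⟨ ℕ.*-monoˡ-≤ M 2V≤P ⟩
      P * M           ≡⟨ ℕ.*-comm P M ⟩
      M * P           ∎)))
    where open ℕ.≤-Reasoning

-- The interval around V/P lies in [V/(2P), 2V/P], so a factor 4 between denominators separates two of them.
module _ {N V P P′ m m′} .{{_ : NonZero N}} .{{_ : NonZero V}} .{{_ : NonZero P}} .{{_ : NonZero P′}}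
  (E : Enclosure N V P m) (E′ : Enclosure N V P′ m′) (4P≤P′ : 4 * P ℕ.≤ P′) where

  private
    module E  = Enclosure E
    module E′ = Enclosure E′
    M M′ : ℕ
    M  = N ^ E.t
    M′ = N ^ E′.t
    instance
      M≢0 : NonZero M
      M≢0 = ℕ.m^n≢0 N E.t
      M′≢0 : NonZero M′
      M′≢0 = ℕ.m^n≢0 N E′.t
      P′V≢0 : NonZero (P′ * V)
      P′V≢0 = ℕ.m*n≢0 P′ V

  enclosures-separated : + suc E′.q / M′ ℚ.≤ + E.q / M
  enclosures-separated = pos/-≤ (suc E′.q) M′ E.q M
    (ℕ.*-cancelʳ-≤ (suc E′.q * M) (E.q * M′) (P′ * V) (begin
      suc E′.q * M * (P′ * V)           ≡⟨ regroup (suc E′.q) M P′ V ⟩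
      (suc E′.q * P′) * (V * M)         ≤⟨ ℕ.*-mono-≤ ([1+q]P≤2VM E′) (VM≤2qP E) ⟩
      2 * (V * M′) * (2 * (E.q * P))    ≡⟨ collect V M′ E.q P ⟩
      E.q * M′ * (4 * P * V)            ≤⟨ ℕ.*-monoʳ-≤ (E.q * M′) (ℕ.*-monoˡ-≤ V 4P≤P′) ⟩
      E.q * M′ * (P′ * V)               ∎))
    where
    open ℕ.≤-Reasoning
    regroup : ∀ a M P V → a * M * (P * V) ≡ (a * P) * (V * M)
    regroup = solve-∀
    collect : ∀ V M q P → 2 * (V * M) * (2 * (q * P)) ≡ q * M * (4 * P * V)
    collect = solve-∀

-- Finite maxima, inclusion and disjointness of intervals.

upperBound : ∀ k (f : Fin k → ℕ) → ∃[ b ] ∀ i → f i ℕ.≤ b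
upperBound zero    f = 0 , λ ()
upperBound (suc k) f with upperBound k (f ∘ Fin.suc)
... | b , f≤b = f Fin.zero ℕ.⊔ b , λ where
  Fin.zero    → ℕ.m≤m⊔n (f Fin.zero) b
  (Fin.suc i) → ℕ.m≤n⇒m≤o⊔n (f Fin.zero) (f≤b i)

[⟩-mono-⊆ : ∀ {a b a′ b′} → a′ ℚ.≤ a → b ℚ.≤ b′ → [ a , b ⟩ ⊆ [ a′ , b′ ⟩
[⟩-mono-⊆ a′≤a b≤b′ (a≤x , x<b) = ℚ.≤-trans a′≤a a≤x , ℚ.<-≤-trans x<b b≤b′

decreasing⇒pairwiseDisjoint : ∀ {N} .{{_ : NonZero N}} (J : ℕ → AdicInterval N) →
  (∀ {a b} → a ℕ.< b → right (J b) ℚ.≤ left (J a)) → PairwiseDisjoint J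
decreasing⇒pairwiseDisjoint J right≤left a b a≢b ((la≤x , x<ra) , (lb≤x , x<rb)) with ℕ.<-cmp a b
... | tri< a<b _ _ = ℚ.<-irrefl refl (ℚ.<-≤-trans x<rb (ℚ.≤-trans (right≤left a<b) la≤x))
... | tri≈ _ a≡b _ = a≢b a≡b
... | tri> _ _ b<a = ℚ.<-irrefl refl (ℚ.<-≤-trans x<ra (ℚ.≤-trans (right≤left b<a) lb≤x))

-- Level and numerators of `I`.

-- I has level s and left endpoint k/v^s; the left endpoint of its last child is n/v^(s+1).
record LastChildData (v V P W : ℕ) : Set where
  field
    s k n         : ℕ
    W≤v^s         : W ℕ.≤ v ^ s
    1+n≡[1+k]v    : suc n ≡ suc k * v
    V[v^1+s]≡1+nP : V * v ^ suc s ≡ suc (n * P)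

abstract
  lastChildData : ∀ v .{{_ : NonTrivial v}} P .{{_ : NonZero P}} B W w →
                  Coprime P v → P ≡ suc (w * v) → LastChildData v (v ^ B) P W
  lastChildData v P B W w P⊥v P≡1+wv
    with d , u , v^[1+d]≡1+uP ← order v P {{nonTrivial⇒nonZero v}} P⊥v
    -- The exponent (1+d)(1+B+W) splits as B + (s+1) with s ≥ W: the first part makes up `V`, and
    -- v^s > s ≥ W.
    with n , eq ← ≡1-^ {w = u} v^[1+d]≡1+uP (suc B + W)
    = finish v∣1+n
    where
    s : ℕ
    s = W + d * (suc B + W)

    B+[1+s]≡ : ∀ B W d → B + suc (W + d * (suc B + W)) ≡ suc d * (suc B + W)
    B+[1+s]≡ = solve-∀

    v^B*v^[1+s]≡ : v ^ B * v ^ suc s ≡ suc (n * P)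
    v^B*v^[1+s]≡ = begin
      v ^ B * v ^ suc s            ≡⟨ ℕ.^-distribˡ-+-* v B (suc s) ⟨
      v ^ (B + suc s)              ≡⟨ cong (v ^_) (B+[1+s]≡ B W d) ⟩
      v ^ (suc d * (suc B + W))    ≡⟨ ℕ.^-*-assoc v (suc d) (suc B + W) ⟨
      (v ^ suc d) ^ (suc B + W)    ≡⟨ eq ⟩
      suc (n * P)                  ∎
      where open ≡-Reasoning

    1+nP≡ : suc (n * P) ≡ n * w * v + suc n
    1+nP≡ = trans (cong (λ x → suc (n * x)) P≡1+wv) (algebra n w v)
      where
      algebra : ∀ n w v → suc (n * suc (w * v)) ≡ n * w * v + suc n
      algebra = solve-∀

    v∣1+n : v ∣ suc n
    -- `v` divides V v^(s+1) = 1 + nP = nwv + (1+n).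
    v∣1+n = ∣m+n∣m⇒∣n
      (subst (v ∣_) (trans v^B*v^[1+s]≡ 1+nP≡) (∣n⇒∣m*n (v ^ B) (m∣m*n (v ^ s))))
      (n∣m*n (n * w))

    W≤v^s : W ℕ.≤ v ^ s
    W≤v^s = ℕ.≤-trans (ℕ.m≤m+n W (d * (suc B + W))) (ℕ.<⇒≤ (n<m^n v s))

    finish : v ∣ suc n → LastChildData v (v ^ B) P W
    -- A zero quotient would force `suc n` to be 0.
    finish (divides (suc k) 1+n≡) = record
      { s = s ; k = k ; n = n ; W≤v^s = W≤v^s ; 1+n≡[1+k]v = 1+n≡ ; V[v^1+s]≡1+nP = v^B*v^[1+s]≡ }

-- The sequence of points ζ = V/P and of intervals `I`.

module Construction (p : ℕ) (p-prime : Prime p) (v : ℕ) .{{_ : NonTrivial v}} (v⊥p : Coprime v p) (B : ℕ) where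

  private
    instance
      p≢0 : NonZero p
      p≢0 = prime⇒nonZero p-prime

      p>1 : NonTrivial p
      p>1 = prime⇒nonTrivial p-prime

      v≢0 : NonZero v
      v≢0 = nonTrivial⇒nonZero v

    V : ℕ
    V = v ^ B

    instance
      V≢0 : NonZero V
      V≢0 = ℕ.m^n≢0 v B

    ord : ∃[ d ] ∃[ w ] p ^ suc d ≡ suc (w * v)
    ord = order p v v⊥p

    o : ℕ
    o = suc (proj₁ ord)

    -- With α = 1 + ℓ, one exponent meets all demands: as a multiple of `o` it gives P ≡ 1 (mod v);
    -- being at least `2 * half ℓ` it makes `P` exceed both 2V and v^(100α); and it grows by at
    -- least 2 with each ℓ, so `P` grows by a factor p^2 ≥ 4.
    half m P : ℕ → ℕ
    half ℓ = V + v ^ (100 * suc ℓ)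
    m ℓ = o * (2 * half ℓ)
    P ℓ = p ^ m ℓ

    P≢0 : ∀ ℓ → NonZero (P ℓ)
    P≢0 ℓ = ℕ.m^n≢0 p (m ℓ)

    P≡1 : ∀ ℓ → ∃[ w ] P ℓ ≡ suc (w * v)
    P≡1 ℓ with ≡1-^ {w = proj₁ (proj₂ ord)} (proj₂ (proj₂ ord)) (2 * half ℓ)
    ... | w , eq = w , trans (sym (ℕ.^-*-assoc p o (2 * half ℓ))) eq

    2half≤P : ∀ ℓ → 2 * half ℓ ℕ.≤ P ℓ
    2half≤P ℓ = ℕ.≤-trans (ℕ.m≤n*m (2 * half ℓ) o) (ℕ.<⇒≤ (n<m^n p (m ℓ)))

    2V≤P : ∀ ℓ → 2 * V ℕ.≤ P ℓ
    2V≤P ℓ = ℕ.≤-trans (ℕ.*-monoʳ-≤ 2 (ℕ.m≤m+n V _)) (2half≤P ℓ)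

    v^100α≤P : ∀ ℓ → v ^ (100 * suc ℓ) ℕ.≤ P ℓ
    v^100α≤P ℓ = ℕ.≤-trans (ℕ.m≤n+m _ V) (ℕ.≤-trans (ℕ.m≤n*m (half ℓ) 2) (2half≤P ℓ))

    1<P : ∀ ℓ → 1 ℕ.< P ℓ
    1<P ℓ = ℕ.≤-trans (ℕ.*-monoʳ-≤ 2 (ℕ.m^n>0 v B)) (2V≤P ℓ)

    2+m≤m : ∀ {a b} → a ℕ.< b → 2 + m a ℕ.≤ m b
    2+m≤m {a} {b} a<b = begin
      2 + o * (2 * half a)     ≤⟨ ℕ.+-monoˡ-≤ (m a) (ℕ.m≤n*m 2 o) ⟩
      o * 2 + o * (2 * half a) ≡⟨ collect o (half a) ⟩
      o * (2 * suc (half a))   ≤⟨ ℕ.*-monoʳ-≤ o (ℕ.*-monoʳ-≤ 2 half<half) ⟩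
      o * (2 * half b)         ∎
      where
      open ℕ.≤-Reasoning
      collect : ∀ o h → o * 2 + o * (2 * h) ≡ o * (2 * suc h)
      collect = solve-∀
      half<half : half a ℕ.< half b
      half<half = ℕ.+-monoʳ-< V (ℕ.^-monoʳ-< v (ℕ.nonTrivial⇒n>1 v) (ℕ.*-monoʳ-< 100 (s≤s a<b)))

    4P≤P : ∀ {a b} → a ℕ.< b → 4 * P a ℕ.≤ P b
    4P≤P {a} {b} a<b = begin
      4 * P a         ≤⟨ ℕ.*-monoˡ-≤ (P a) (ℕ.^-monoˡ-≤ 2 (ℕ.nonTrivial⇒n>1 p)) ⟩
      p ^ 2 * P a     ≡⟨ ℕ.^-distribˡ-+-* p 2 (m a) ⟨
      p ^ (2 + m a)   ≤⟨ ℕ.^-monoʳ-≤ p (2+m≤m a<b) ⟩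
      P b             ∎
      where open ℕ.≤-Reasoning

    P⊥v : ∀ ℓ → Coprime (P ℓ) v
    P⊥v ℓ = Coprimality.sym (coprime-^ (m ℓ) v⊥p)

    -- Bounds P N^t for every base N ≤ V and level t < m, so that one interval `I` is short enough
    -- for all bases at once.
    W : ℕ → ℕ
    W ℓ = P ℓ * V ^ m ℓ

    D : ∀ ℓ → LastChildData v V (P ℓ) (W ℓ)
    D ℓ = lastChildData v (P ℓ) {{P≢0 ℓ}} B (W ℓ) (proj₁ (P≡1 ℓ)) (P⊥v ℓ) (proj₂ (P≡1 ℓ))

    module D ℓ = LastChildData (D ℓ)
    module L ℓ = LastChild v (D.s ℓ) (D.k ℓ) (D.n ℓ) V (P ℓ) {{v≢0}} {{P≢0 ℓ}}
      (1<P ℓ) (D.1+n≡[1+k]v ℓ) (D.V[v^1+s]≡1+nP ℓ)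

  ζ : ℕ → ℚ
  ζ ℓ = _/_ (+ V) (P ℓ) {{P≢0 ℓ}}

  I : ℕ → AdicInterval v
  I ℓ = L.I ℓ

  0<ζ-Z : ∀ ℓ → 0ℚ ℚ.< ζ ℓ ℚ.- Z (I ℓ)
  0<ζ-Z ℓ = L.0<ζ-Z ℓ

  ζ-Z≤ : ∀ ℓ → ζ ℓ ℚ.- Z (I ℓ) ℚ.≤ 1ℤ /[ v ^ + (100 * suc ℓ) ] ℚ.* length (I ℓ)
  ζ-Z≤ ℓ = L.ζ-Z≤ ℓ (v ^ (100 * suc ℓ)) {{ℕ.m^n≢0 v (100 * suc ℓ)}} (v^100α≤P ℓ)

  -- The intervals `J` of one base `N`, around points ζ shared by all bases.

  module Enclosing (N : ℕ) .{{_ : NonZero N}} (p∣N : p ∣ N) (N≤B : N ℕ.≤ B) where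

    private
      N≤V : N ℕ.≤ V
      N≤V = ℕ.≤-trans N≤B (ℕ.<⇒≤ (n<m^n v B))

      E : ∀ ℓ → Enclosure N V (P ℓ) (m ℓ)
      E ℓ = enclose {{it}} {{P≢0 ℓ}} N≤V (1<P ℓ) (coprime-^ B (P⊥v ℓ)) (^-monoˡ-∣ (m ℓ) p∣N)

      module E ℓ = Enclosure (E ℓ)
      module IP ℓ = InteriorPoint N (E.t ℓ) (E.q ℓ) V (P ℓ) {{it}} {{P≢0 ℓ}}
        (E.qP<VM ℓ) (E.VM<[1+q]P ℓ) (E.P∣NM ℓ)

      N^t≢0 : ∀ ℓ → NonZero (N ^ E.t ℓ)
      N^t≢0 ℓ = ℕ.m^n≢0 N (E.t ℓ)

      PM≤v^s : ∀ ℓ → P ℓ * N ^ E.t ℓ ℕ.≤ v ^ D.s ℓ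
      PM≤v^s ℓ = ℕ.≤-trans (ℕ.*-monoʳ-≤ (P ℓ) (ℕ.≤-trans (ℕ.^-monoˡ-≤ (E.t ℓ) N≤V)
        (ℕ.^-monoʳ-≤ V (ℕ.<⇒≤ (E.t<m ℓ))))) (D.W≤v^s ℓ)

    J : ℕ → AdicInterval N
    J ℓ = IP.J ℓ

    I⊆J : ∀ ℓ → ⟦ I ℓ ⟧ ⊆ ⟦ J ℓ ⟧
    I⊆J ℓ = [⟩-mono-⊆
      (L.q/M≤left ℓ (N ^ E.t ℓ) (E.q ℓ) {{N^t≢0 ℓ}} (E.qP<VM ℓ) (E.VM<[1+q]P ℓ) (PM≤v^s ℓ))
      (L.right≤[1+q]/M ℓ (N ^ E.t ℓ) (E.q ℓ) {{N^t≢0 ℓ}} (E.qP<VM ℓ) (E.VM<[1+q]P ℓ) (PM≤v^s ℓ))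

    smallestContaining : ∀ ℓ → SmallestContaining ⟦ I ℓ ⟧ (J ℓ)
    -- `J′` contains the two points `left I` and ζ of `I`, and `left I` < ζ, so ζ lies strictly
    -- inside `J′`.
    smallestContaining ℓ = I⊆J ℓ , λ J′ I⊆J′ → IP.nested ℓ J′
      (ℚ.≤-<-trans (proj₁ (I⊆J′ (L.left∈I ℓ))) (L.left<ζ ℓ))
      (proj₂ (I⊆J′ (L.ζ∈I ℓ)))

    J⊆unit : ∀ ℓ → ⟦ J ℓ ⟧ ⊆ [ 0ℚ , 1ℚ ⟩
    J⊆unit ℓ = [⟩-mono-⊆ (pos/-≤ 0 1 (E.q ℓ) (N ^ E.t ℓ) {{it}} {{N^t≢0 ℓ}} z≤n) (enclosure≤1 {{it}} {{P≢0 ℓ}} (E ℓ) (2V≤P ℓ))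

    pairwiseDisjoint : PairwiseDisjoint J
    pairwiseDisjoint = decreasing⇒pairwiseDisjoint J λ {a} {b} a<b →
      enclosures-separated {{it}} {{it}} {{P≢0 a}} {{P≢0 b}} (E a) (E b) (4P≤P a<b)

    interiorChildEndpoint : ∀ ℓ → InteriorChildEndpoint (J ℓ) (ζ ℓ)
    interiorChildEndpoint ℓ = IP.interiorChildEndpoint ℓ

-- All bases p c_i treated together.

theorem2p5 :
    ∀ (p : ℕ) (p-prime : Prime p)
      (k : ℕ) (c : Fin k → ℕ) (c≢0 : ∀ i → NonZero (c i))
      (v : ℕ) .{{_ : NonTrivial v}} → Coprime v p →
    let instance
          v≢0 : NonZero v
          v≢0 = nonTrivial⇒nonZero v
          pc≢0 : ∀ {i} → NonZero (p * c i)
          pc≢0 {i} = m*n≢0 p (c i) {{prime⇒nonZero p-prime}} {{c≢0 i}}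
    in
    Σ[ I ∈ (ℕ → AdicInterval v) ]
    Σ[ α ∈ (ℕ → ℕ) ]
    Σ[ J ∈ (∀ i → ℕ → AdicInterval (p * c i)) ]
      (∀ ℓ → ⟦ I ℓ ⟧ ⊆ [ 0ℚ , 1ℚ ⟩)
    × (∀ ℓ → 0 ℕ.< α ℓ)
    × (∀ i ℓ → SmallestContaining ⟦ I ℓ ⟧ (J i ℓ))
    × (∀ i → PairwiseDisjoint (J i))
    × (∀ i ℓ → ⟦ J i ℓ ⟧ ⊆ [ 0ℚ , 1ℚ ⟩)
    × PairwiseDisjoint I
    × (∀ a → FinitelyMany (λ ℓ → α ℓ ≡ a))
    × (∀ ℓ i → ∃[ ζ ] InteriorChildEndpoint (J i ℓ) ζ
                    × 0ℚ ℚ.< ζ ℚ.- Z (I ℓ)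
                    × ζ ℚ.- Z (I ℓ) ℚ.≤ 1ℤ /[ v ^ + (100 * α ℓ) ] ℚ.* length (I ℓ))
theorem2p5 p p-prime k c c≢0 v v⊥p =
    I , suc , J′.J
  , (λ ℓ → Jp.J⊆unit ℓ ∘ Jp.I⊆J ℓ)
  , (λ ℓ → s≤s z≤n)
  , J′.smallestContaining
  , J′.pairwiseDisjoint
  , J′.J⊆unit
  , (λ a b a≢b → λ (x∈Ia , x∈Ib) → Jp.pairwiseDisjoint a b a≢b (Jp.I⊆J a x∈Ia , Jp.I⊆J b x∈Ib))
  , (λ a → ℕ.pred a ∷ [] , λ ℓ 1+ℓ≡a → here (cong ℕ.pred 1+ℓ≡a))
  , (λ ℓ i → ζ ℓ , J′.interiorChildEndpoint i ℓ , 0<ζ-Z ℓ , ζ-Z≤ ℓ)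
  where
  pc-bound : ∃[ b ] ∀ i → p * c i ℕ.≤ b
  pc-bound = upperBound k (λ i → p * c i)

  -- This `B` bounds every p c_i, and also p itself, which serves as an additional base.
  open Construction p p-prime v v⊥p (p + proj₁ pc-bound)

  module J′ i = Enclosing (p * c i) {{m*n≢0 p (c i) {{prime⇒nonZero p-prime}} {{c≢0 i}}}}
    (m∣m*n (c i)) (ℕ.m≤n⇒m≤o+n p (proj₂ pc-bound i))
  -- For k = 0 there are no J i, so the I ℓ are separated by p-adic intervals instead.
  module Jp = Enclosing p {{prime⇒nonZero p-prime}} ∣-refl (ℕ.m≤m+n p (proj₁ pc-bound))
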